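{- Let $n\ge 0$ be an integer. The variance of the statistic $JD$ (sum of jump distances) on the set of full binary trees with $n$ internal vertices, equipped with the uniform distribution, is $$ \frac{2 n \left(2 n^{2}-n -1\right)}{n^{3}+7 n^{2}+16 n +12}. $$
   Context: A full binary tree is an unlabeled ordered tree defined recursively: it is either the single-vertex tree, denoted $\cdot$, or a pair $T=[T_L,T_R]$ where $T_L$ (left subtree) and $T_R$ (right subtree) are full binary trees. The number of internal vertices $V(T)$ is defined by $V(\cdot)=0$, $V([T_L,T_R])=V(T_L)+V(T_R)+1$. The depth of the rightmost leaf $D(T)$ is defined by $D(\cdot)=0$, $D([T_L,T_R])=1+D(T_R)$. The sum of jump distances $JD(T)$ is defined by $JD(\cdot)=0$, $JD([T_L,T_R])=JD(T_L)+JD(T_R)+D(T_L)$. -}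

module Defs where

open import Data.Nat.Base as ℕ using (ℕ; zero; suc; NonZero; _≤_; s≤s)
import Data.Nat.Properties as ℕₚ
open import Data.Integer.Base using (+_)
open import Data.Rational.Base as ℚ using (ℚ; 0ℚ)
open import Data.List.Base
  using (List; []; _∷_; length; map; foldr; filter; cartesianProductWith)
open import Data.List.Membership.Propositional using (_∈_)
open import Data.List.Membership.Propositional.Properties
  using (∈-cartesianProductWith⁺; ∈-cartesianProductWith⁻; ∈-filter⁺; ∈-filter⁻)
open import Data.List.Relation.Unary.Any using (here; there)
open import Data.List.Relation.Unary.All using (tabulate)
open import Data.List.Relation.Unary.AllPairs using ([]; _∷_)
open import Data.List.Relation.Unary.Unique.Propositional using (Unique)
import Data.List.Relation.Unary.Unique.Propositional.Properties as Uniqueₚ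
open import Data.Product.Base using (_×_; _,_; proj₂)
open import Function.Bundles using (_⇔_; mk⇔)
open import Relation.Binary.PropositionalEquality using (_≡_; _≢_; refl; cong)

data Tree : Set where
  leaf : Tree
  node : (l r : Tree) → Tree

-- internal vertices
V : Tree → ℕ
V leaf       = 0
V (node l r) = V l ℕ.+ V r ℕ.+ 1

-- depth of the rightmost leaf
D : Tree → ℕ
D leaf       = 0
D (node l r) = 1 ℕ.+ D r

-- sum of jump distances
JD : Tree → ℕ
JD leaf       = 0
JD (node l r) = JD l ℕ.+ JD r ℕ.+ D l

-- All trees of height at most h, each listed once.
treesOfHeight≤ : ℕ → List Tree
treesOfHeight≤ zero    = leaf ∷ []
treesOfHeight≤ (suc h) =
  leaf ∷ cartesianProductWith node (treesOfHeight≤ h) (treesOfHeight≤ h)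

-- The set of trees with n internal vertices, as a duplicate-free list.
-- The height bound loses nothing, since the height of t is at most V t:
-- see ∈-trees⇔ and trees-unique below.
trees : ℕ → List Tree
trees n = filter (λ t → V t ℕₚ.≟ n) (treesOfHeight≤ n)

V≤⇒∈ : ∀ h t → V t ≤ h → t ∈ treesOfHeight≤ h
V≤⇒∈ zero    leaf       _ = here refl
V≤⇒∈ zero    (node l r) p rewrite ℕₚ.+-comm (V l ℕ.+ V r) 1 with () ← p
V≤⇒∈ (suc h) leaf       _ = here refl
V≤⇒∈ (suc h) (node l r) p rewrite ℕₚ.+-comm (V l ℕ.+ V r) 1 with s≤s q ← p =
  there (∈-cartesianProductWith⁺ node
    (V≤⇒∈ h l (ℕₚ.m+n≤o⇒m≤o (V l) q))
    (V≤⇒∈ h r (ℕₚ.m+n≤o⇒n≤o (V l) q)))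

∈-trees⇔ : ∀ n t → t ∈ trees n ⇔ V t ≡ n
∈-trees⇔ n t = mk⇔
  (λ p → proj₂ (∈-filter⁻ (λ t → V t ℕₚ.≟ n) {xs = treesOfHeight≤ n} p))
  (λ p → ∈-filter⁺ (λ t → V t ℕₚ.≟ n) (V≤⇒∈ n t (ℕₚ.≤-reflexive p)) p)

treesOfHeight≤-unique : ∀ h → Unique (treesOfHeight≤ h)
treesOfHeight≤-unique zero    = tabulate (λ ()) ∷ []
treesOfHeight≤-unique (suc h) =
  tabulate leaf≢ ∷
  Uniqueₚ.cartesianProductWith⁺ node (λ { refl → refl , refl })
    (treesOfHeight≤-unique h) (treesOfHeight≤-unique h)
  where
  ts = treesOfHeight≤ h
  leaf≢ : ∀ {t} → t ∈ cartesianProductWith node ts ts → leaf ≢ t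
  leaf≢ p refl with _ , _ , _ , _ , () ← ∈-cartesianProductWith⁻ node ts ts p

trees-unique : ∀ n → Unique (trees n)
trees-unique n = Uniqueₚ.filter⁺ (λ t → V t ℕₚ.≟ n) (treesOfHeight≤-unique n)

leftComb : ℕ → Tree
leftComb zero    = leaf
leftComb (suc n) = node (leftComb n) leaf

V-leftComb : ∀ n → V (leftComb n) ≡ n
V-leftComb zero    = refl
V-leftComb (suc n)
  rewrite V-leftComb n | ℕₚ.+-identityʳ n = ℕₚ.+-comm n 1

∈⇒length≢0 : ∀ {A : Set} {x : A} {xs} → x ∈ xs → NonZero (length xs)
∈⇒length≢0 {xs = _ ∷ _} _ = _

trees-nonEmpty : ∀ n → NonZero (length (trees n))
trees-nonEmpty n = ∈⇒length≢0
  (∈-filter⁺ (λ t → V t ℕₚ.≟ n)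
    (V≤⇒∈ n (leftComb n) (ℕₚ.≤-reflexive (V-leftComb n))) (V-leftComb n))

-- Accepts polynomials with a nonzero constant term as denominators.
instance
  +suc-nonZero : ∀ {m k} → NonZero (m ℕ.+ suc k)
  +suc-nonZero {m} {k} rewrite ℕₚ.+-suc m k = _

-- Expectation and variance of X for the uniform distribution on the entries
-- of a nonempty list.
module _ {A : Set} where

  expectation : (X : A → ℚ) (xs : List A) → .{{NonZero (length xs)}} → ℚ
  expectation X xs = foldr ℚ._+_ 0ℚ (map X xs) ℚ.* (+ 1 ℚ./ length xs)

  variance : (X : A → ℚ) (xs : List A) → .{{NonZero (length xs)}} → ℚ
  variance X xs = expectation (λ x → (X x ℚ.- μ) ℚ.* (X x ℚ.- μ)) xs
    where μ = expectation X xs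

{-# OPTIONS --safe #-}

-- Every internal vertex lies on exactly one maximal right chain, and a chain starts
-- at the root, with D t vertices, or at a left child l, with D l vertices; hence
-- JD t + D t = V t, and it suffices to find the first two moments of D.
--
-- Every tree with n + 1 internal vertices arises from exactly one tree t with n of
-- them by inserting a vertex, with leaf as right child, at one of the D t + 1 places
-- of the right spine; the new values of D are 1, …, D t + 1.  So
--   Σ_{V t = n+1} f (D t) = Σ_{V t = n} (f 1 + … + f (D t + 1)),
-- and iterating f ↦ (d ↦ f 1 + … + f (d + 1)) from f = 1 expresses the moments of D
-- by the Catalan numbers C_n, C_{n+1}, C_{n+2}:
--   Σ (D + 1) = C_{n+1},   Σ (D + 1) (D + 4) = 2 C_{n+2}.
module Submission where

open import Defs
open import Data.Nat.Base as ℕ using (ℕ; zero; suc; NonZero)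
open import Data.Nat.ListAction using (sum)
open import Data.Nat.ListAction.Properties using (sum-++; sum-↭)
import Data.Nat.Properties as ℕₚ
import Data.Nat.Tactic.RingSolver as ℕ-Solver
open import Data.Integer.Base as ℤ using (ℤ; +_)
import Data.Integer.Properties as ℤₚ
import Data.Integer.Tactic.RingSolver as ℤ-Solver
open import Data.Rational.Base as ℚ using (ℚ; 0ℚ; 1ℚ; fromℚᵘ; toℚᵘ)
import Data.Rational.Properties as ℚₚ
import Data.Rational.Solver as ℚ-Solver
import Data.Rational.Unnormalised.Base as ℚᵘ
import Data.Rational.Unnormalised.Properties as ℚᵘₚ
open import Data.List.Base using (List; []; _∷_; _++_; map; concatMap; foldr; length)
open import Data.List.Properties using (map-++; map-∘; map-cong)
open import Data.List.Membership.Propositional using (_∈_; lose; find)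
open import Data.List.Membership.Propositional.Properties
  using (∈-map⁺; ∈-map⁻; ∈-concatMap⁺; ∈-concatMap⁻)
open import Data.List.Membership.Propositional.Properties.WithK using (unique∧set⇒bag)
open import Data.List.Relation.Binary.BagAndSetEquality using (∼bag⇒↭)
open import Data.List.Relation.Binary.Permutation.Propositional using (_↭_)
import Data.List.Relation.Binary.Permutation.Propositional.Properties as ↭
open import Data.List.Relation.Unary.All as All using ([])
import Data.List.Relation.Unary.All.Properties as All
open import Data.List.Relation.Unary.Any using (here; there)
open import Data.List.Relation.Unary.AllPairs as AllPairs using ([]; _∷_)
import Data.List.Relation.Unary.AllPairs.Properties as AllPairs
open import Data.List.Relation.Unary.Unique.Propositional using (Unique)
import Data.List.Relation.Unary.Unique.Propositional.Properties as Unique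
open import Data.Product.Base using (_,_; proj₂)
open import Function.Base using (_∘_)
open import Function.Bundles using (mk⇔; module Equivalence)
open import Relation.Binary.PropositionalEquality
  using (_≡_; _≢_; refl; sym; trans; cong; cong₂; module ≡-Reasoning)
import Relation.Binary.Reasoning.Setoid as ≈-Reasoning

-- The generating tree: insertion of a vertex on the right spine.

module _ where
  open import Data.Nat.Base using (_+_; _*_)
  open ℕₚ using (+-assoc; +-comm; +-identityʳ; +-suc; *-identityˡ; *-cancelʳ-≡; suc-injective)
  open ℕ-Solver using (solve-∀)
  open ≡-Reasoning

  -- The subtree at the chosen place of the right spine becomes the left child of the new vertex.
  -- Places run from the root downwards, so `D` takes the values 1, 2, ... along the list.
  children : Tree → List Tree
  children leaf       = node leaf leaf ∷ []
  children (node l r) = node (node l r) leaf ∷ map (node l) (children r)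

  -- Undoes an insertion: the inserted vertex is the last one on the right spine, and its left
  -- subtree takes its place. `leaf` is nobody's child and gets itself as a default value.
  parent : Tree → Tree
  parent leaf                  = leaf
  parent (node l leaf)         = l
  parent (node l r@(node _ _)) = node l (parent r)

  parent-child : ∀ {t c} → c ∈ children t → parent c ≡ t
  parent-child {leaf}     (here refl) = refl
  parent-child {node l r} (here refl) = refl
  parent-child {node l r} (there c∈) with ∈-map⁻ (node l) c∈
  -- `parent (node l c′)` reduces to the recursive case only if `c′` is a node; every child is one,
  -- which refutes the two cases with `leaf`.
  parent-child {node l leaf}       (there c∈) | leaf , here () , refl
  parent-child {node l (node _ _)} (there c∈) | leaf , c′∈ , refl with c′∈
  ... | there p with () ← proj₂ (proj₂ (∈-map⁻ _ p))
  parent-child {node l r} (there c∈) | node _ _ , c′∈ , refl = cong (node l) (parent-child c′∈)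

  V-child : ∀ {t c} → c ∈ children t → V c ≡ suc (V t)
  V-child {leaf}     (here refl) = refl
  V-child {node l r} (here refl) = begin
    V l + V r + 1 + 0 + 1   ≡⟨ cong (_+ 1) (+-identityʳ (V l + V r + 1)) ⟩
    V l + V r + 1 + 1       ≡⟨ +-comm (V l + V r + 1) 1 ⟩
    suc (V l + V r + 1)     ∎
  V-child {node l r} (there c∈) with ∈-map⁻ (node l) c∈
  ... | c′ , c′∈ , refl = begin
    V l + V c′ + 1        ≡⟨ cong (λ v → V l + v + 1) (V-child c′∈) ⟩
    V l + suc (V r) + 1   ≡⟨ cong (_+ 1) (+-suc (V l) (V r)) ⟩
    suc (V l + V r + 1)   ∎

  -- Together with `parent-child`, every tree except `leaf` is a child of exactly one tree. The
  -- split on the left subtree lets `children` reduce.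
  node∈children-parent : ∀ l r → node l r ∈ children (parent (node l r))
  node∈children-parent leaf       leaf           = here refl
  node∈children-parent (node _ _) leaf           = here refl
  node∈children-parent l          (node r₁ r₂)   = there (∈-map⁺ (node l) (node∈children-parent r₁ r₂))

  generation : ℕ → List Tree
  generation zero    = leaf ∷ []
  generation (suc n) = concatMap children (generation n)

  ∈-generation⁻ : ∀ n {t} → t ∈ generation n → V t ≡ n
  ∈-generation⁻ zero    (here refl) = refl
  ∈-generation⁻ (suc n) t∈ with find (∈-concatMap⁻ children {xs = generation n} t∈)
  ... | p , p∈ , t∈children = trans (V-child t∈children) (cong suc (∈-generation⁻ n p∈))

  V≢0 : ∀ l r → V (node l r) ≢ 0
  V≢0 l r eq with () ← trans (sym (+-suc (V l + V r) 0)) eq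

  ∈-generation⁺ : ∀ n {t} → V t ≡ n → t ∈ generation n
  ∈-generation⁺ zero    {leaf}     _  = here refl
  ∈-generation⁺ zero    {node l r} eq with () ← V≢0 l r eq
  ∈-generation⁺ (suc n) {node l r} eq =
    ∈-concatMap⁺ children (lose (∈-generation⁺ n V-parent) (node∈children-parent l r))
    where
    V-parent : V (parent (node l r)) ≡ n
    V-parent = suc-injective (trans (sym (V-child (node∈children-parent l r))) eq)

  children-unique : ∀ t → Unique (children t)
  children-unique leaf       = [] ∷ []
  children-unique (node l r) =
    All.tabulate new∉ ∷ Unique.map⁺ (λ { refl → refl }) (children-unique r)
    where
    new∉ : ∀ {c} → c ∈ map (node l) (children r) → node (node l r) leaf ≢ c
    new∉ c∈ refl with _ , _ , () ← ∈-map⁻ (node l) {xs = children r} c∈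

  generation-unique : ∀ n → Unique (generation n)
  generation-unique zero    = [] ∷ []
  generation-unique (suc n) = Unique.concat⁺
    (All.map⁺ (All.universal children-unique (generation n)))
    (AllPairs.map⁺ (AllPairs.map
      -- A common child of `s` and `t` would have both as its `parent`.
      (λ s≢t {_} (c∈s , c∈t) → s≢t (trans (sym (parent-child c∈s)) (parent-child c∈t)))
      (generation-unique n)))

  -- Both lists are duplicate-free and have the same members, so sums over `trees n` can be taken
  -- along the generating tree.
  trees↭generation : ∀ n → trees n ↭ generation n
  trees↭generation n = ∼bag⇒↭ (unique∧set⇒bag (trees-unique n) (generation-unique n)
    (mk⇔ (∈-generation⁺ n ∘ Equivalence.to (∈-trees⇔ n _))
         (Equivalence.from (∈-trees⇔ n _) ∘ ∈-generation⁻ n)))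

  -- Sums over a generation and ballot numbers.

  partialSum : (ℕ → ℕ) → ℕ → ℕ
  partialSum f zero    = f 1
  -- Splitting off the first summand and shifting `f` mirrors the recursion of `children` along the
  -- spine.
  partialSum f (suc d) = f 1 + partialSum (f ∘ suc) d

  partialSum-suc : ∀ f d → partialSum f (suc d) ≡ partialSum f d + f (2 + d)
  partialSum-suc f zero    = refl
  partialSum-suc f (suc d) = begin
    f 1 + partialSum (f ∘ suc) (suc d)             ≡⟨ cong (_+_ (f 1)) (partialSum-suc (f ∘ suc) d) ⟩
    f 1 + (partialSum (f ∘ suc) d + f (3 + d))     ≡⟨ +-assoc (f 1) _ _ ⟨
    f 1 + partialSum (f ∘ suc) d + f (3 + d)       ∎

  sum-children : ∀ f t → sum (map (f ∘ D) (children t)) ≡ partialSum f (D t)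
  sum-children f leaf       = +-identityʳ (f 1)
  sum-children f (node l r) = cong (_+_ (f 1)) (begin
    sum (map (f ∘ D) (map (node l) (children r)))  ≡⟨ cong sum (map-∘ (children r)) ⟨
    sum (map (f ∘ suc ∘ D) (children r))           ≡⟨ sum-children (f ∘ suc) r ⟩
    partialSum (f ∘ suc) (D r)                     ∎)

  sum-concatMap : ∀ {A B : Set} (f : B → ℕ) (g : A → List B) xs →
    sum (map f (concatMap g xs)) ≡ sum (map (λ x → sum (map f (g x))) xs)
  sum-concatMap f g []       = refl
  sum-concatMap f g (x ∷ xs) = begin
    sum (map f (g x ++ concatMap g xs))                  ≡⟨ cong sum (map-++ f (g x) _) ⟩
    sum (map f (g x) ++ map f (concatMap g xs))          ≡⟨ sum-++ (map f (g x)) _ ⟩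
    sum (map f (g x)) + sum (map f (concatMap g xs))     ≡⟨ cong (_+_ (sum (map f (g x)))) (sum-concatMap f g xs) ⟩
    sum (map f (g x)) + sum (map (λ x → sum (map f (g x))) xs) ∎

  -- The ballot numbers: `ballot n d` counts the trees that `n` successive insertions produce from a
  -- tree whose `D` is `d`.
  ballot : ℕ → ℕ → ℕ
  ballot zero    _ = 1
  ballot (suc n)   = partialSum (ballot n)

  -- Going back one generation applies `partialSum` once to the summand: `n` falls and `k` rises by
  -- one. In counting terms, the descendants of generation `n` after `k` insertions form generation
  -- `k + n`.
  sum-generation-ballot : ∀ n k → sum (map (ballot k ∘ D) (generation n)) ≡ ballot (k + n) 0
  sum-generation-ballot zero    k = begin
    ballot k 0 + 0  ≡⟨ +-identityʳ (ballot k 0) ⟩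
    ballot k 0      ≡⟨ cong (λ m → ballot m 0) (+-identityʳ k) ⟨
    ballot (k + 0) 0 ∎
  sum-generation-ballot (suc n) k = begin
    sum (map (ballot k ∘ D) (generation (suc n)))
      ≡⟨ sum-concatMap (ballot k ∘ D) children (generation n) ⟩
    sum (map (λ t → sum (map (ballot k ∘ D) (children t))) (generation n))
      ≡⟨ cong sum (map-cong (sum-children (ballot k)) (generation n)) ⟩
    sum (map (ballot (suc k) ∘ D) (generation n))  ≡⟨ sum-generation-ballot n (suc k) ⟩
    ballot (suc k + n) 0                           ≡⟨ cong (λ m → ballot m 0) (+-suc k n) ⟨
    ballot (k + suc n) 0                           ∎

  sum-trees-ballot : ∀ n k → sum (map (ballot k ∘ D) (trees n)) ≡ ballot (k + n) 0
  sum-trees-ballot n k = trans (sum-↭ (↭.map⁺ (ballot k ∘ D) (trees↭generation n))) (sum-generation-ballot n k)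

  -- Pascal recurrence and ratios of ballot numbers.

  ballot-pascal : ∀ n d → ballot (1 + n) (1 + d) ≡ ballot (1 + n) d + ballot n (2 + d)
  ballot-pascal n d = partialSum-suc (ballot n) d

  -- ballot n d = (d + 1) / (2n + d + 1) · C(2n + d + 1, n).  The three lemmas are the
  -- ratios of neighbouring values of this formula, cleared of denominators; each
  -- needs the others at smaller arguments.
  mutual
    ballot-ratio-d : ∀ n d → ballot n (1 + d) * ((1 + d) * (2 + n + d)) ≡ ballot n d * ((2 + d) * (1 + (n + n + d)))
    ballot-ratio-d zero    d = lem d where
      lem : ∀ d → 1 * ((1 + d) * (2 + 0 + d)) ≡ 1 * ((2 + d) * (1 + (0 + 0 + d)))
      lem = solve-∀
    ballot-ratio-d (suc n) d = begin
      ballot (1 + n) (1 + d) * ((1 + d) * (3 + n + d))  ≡⟨ cong (_* ((1 + d) * (3 + n + d))) (ballot-pascal n d) ⟩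
      (z + y) * ((1 + d) * (3 + n + d))                ≡⟨ lem₁ n d z y ⟩
      z * ((1 + d) * (3 + n + d)) + y * ((1 + d) * (3 + n + d)) ≡⟨ cong (_+_ (z * ((1 + d) * (3 + n + d)))) (ballot-ratio-skew n d) ⟩
      z * ((1 + d) * (3 + n + d)) + z * ((1 + n) * (3 + d)) ≡⟨ lem₂ n d z ⟩
      z * ((2 + d) * (1 + (1 + n + (1 + n) + d)))      ∎
      where
      z = ballot (1 + n) d
      y = ballot n (2 + d)
      lem₁ : ∀ n d z y → (z + y) * ((1 + d) * (3 + n + d)) ≡ z * ((1 + d) * (3 + n + d)) + y * ((1 + d) * (3 + n + d))
      lem₁ = solve-∀
      lem₂ : ∀ n d z → z * ((1 + d) * (3 + n + d)) + z * ((1 + n) * (3 + d)) ≡ z * ((2 + d) * (1 + (1 + n + (1 + n) + d)))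
      lem₂ = solve-∀

    ballot-ratio-n : ∀ n d → ballot (1 + n) d * ((2 + d) * (1 + n)) ≡ ballot n (1 + d) * ((1 + d) * (2 + (n + n + d)))
    -- `ballot (1 + n) 0` is `ballot n 1` by definition, so only the coefficients differ.
    ballot-ratio-n n zero    = cong (ballot n 1 *_) (lem n) where
      lem : ∀ n → (2 + 0) * (1 + n) ≡ (1 + 0) * (2 + (n + n + 0))
      lem = solve-∀
    ballot-ratio-n n (suc d) = begin
      ballot (1 + n) (1 + d) * ((3 + d) * (1 + n))  ≡⟨ cong (_* ((3 + d) * (1 + n))) (ballot-pascal n d) ⟩
      (z + y) * ((3 + d) * (1 + n))                 ≡⟨ lem₁ n d z y ⟩
      z * ((1 + n) * (3 + d)) + y * ((3 + d) * (1 + n)) ≡⟨ cong (_+ y * ((3 + d) * (1 + n))) (ballot-ratio-skew n d) ⟨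
      y * ((1 + d) * (3 + n + d)) + y * ((3 + d) * (1 + n)) ≡⟨ lem₂ n d y ⟩
      y * ((2 + d) * (2 + (n + n + (1 + d))))       ∎
      where
      z = ballot (1 + n) d
      y = ballot n (2 + d)
      lem₁ : ∀ n d z y → (z + y) * ((3 + d) * (1 + n)) ≡ z * ((1 + n) * (3 + d)) + y * ((3 + d) * (1 + n))
      lem₁ = solve-∀
      lem₂ : ∀ n d y → y * ((1 + d) * (3 + n + d)) + y * ((3 + d) * (1 + n)) ≡ y * ((2 + d) * (2 + (n + n + (1 + d))))
      lem₂ = solve-∀

    ballot-ratio-skew : ∀ n d → ballot n (2 + d) * ((1 + d) * (3 + n + d)) ≡ ballot (1 + n) d * ((1 + n) * (3 + d))
    -- The skew ratio is composed of the other two through `ballot n (1 + d)`; the extra factor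
    -- `2 + d` clears the intermediate denominator.
    ballot-ratio-skew n d = *-cancelʳ-≡ _ _ (2 + d) (begin
      y * ((1 + d) * (3 + n + d)) * (2 + d)                    ≡⟨ lem₁ n d y ⟩
      y * ((1 + (1 + d)) * (2 + n + (1 + d))) * (1 + d)        ≡⟨ cong (_* (1 + d)) (ballot-ratio-d n (1 + d)) ⟩
      x * ((2 + (1 + d)) * (1 + (n + n + (1 + d)))) * (1 + d)  ≡⟨ lem₂ n d x ⟩
      x * ((1 + d) * (2 + (n + n + d))) * (3 + d)              ≡⟨ cong (_* (3 + d)) (ballot-ratio-n n d) ⟨
      z * ((2 + d) * (1 + n)) * (3 + d)                        ≡⟨ lem₃ n d z ⟩
      z * ((1 + n) * (3 + d)) * (2 + d)                        ∎)
      where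
      x = ballot n (1 + d)
      y = ballot n (2 + d)
      z = ballot (1 + n) d
      lem₁ : ∀ n d y → y * ((1 + d) * (3 + n + d)) * (2 + d) ≡ y * ((1 + (1 + d)) * (2 + n + (1 + d))) * (1 + d)
      lem₁ = solve-∀
      lem₂ : ∀ n d x → x * ((2 + (1 + d)) * (1 + (n + n + (1 + d)))) * (1 + d) ≡ x * ((1 + d) * (2 + (n + n + d))) * (3 + d)
      lem₂ = solve-∀
      lem₃ : ∀ n d z → z * ((2 + d) * (1 + n)) * (3 + d) ≡ z * ((1 + n) * (3 + d)) * (2 + d)
      lem₃ = solve-∀

  -- The first two moments of `JD`.

  JD+D≡V : ∀ t → JD t + D t ≡ V t
  JD+D≡V leaf       = refl
  JD+D≡V (node l r) = begin
    -- The jump `D l` completes the count for `l`, and the root supplies the final 1.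
    JD l + JD r + D l + (1 + D r)    ≡⟨ lem (JD l) (JD r) (D l) (D r) ⟩
    JD l + D l + (JD r + D r) + 1    ≡⟨ cong₂ (λ a b → a + b + 1) (JD+D≡V l) (JD+D≡V r) ⟩
    V l + V r + 1                    ∎
    where
    lem : ∀ a b c d → a + b + c + (1 + d) ≡ a + c + (b + d) + 1
    lem = solve-∀

  -- `ballot 0`, `ballot 1` and `ballot 2` are polynomials in `d` of degrees 0, 1 and 2, so their
  -- sums determine the first two moments of `D`.
  ballot-1 : ∀ d → ballot 1 d ≡ 1 + d
  ballot-1 zero    = refl
  ballot-1 (suc d) = trans (partialSum-suc (ballot 0) d) (trans (cong (_+ 1) (ballot-1 d)) (lem d))
    where
    lem : ∀ d → 1 + d + 1 ≡ 2 + d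
    lem = solve-∀

  ballot-2 : ∀ d → 2 * ballot 2 d ≡ (1 + d) * (4 + d)
  ballot-2 zero    = refl
  ballot-2 (suc d) = begin
    2 * ballot 2 (1 + d)               ≡⟨ cong (2 *_) (ballot-pascal 1 d) ⟩
    2 * (ballot 2 d + ballot 1 (2 + d)) ≡⟨ cong (λ b → 2 * (ballot 2 d + b)) (ballot-1 (2 + d)) ⟩
    2 * (ballot 2 d + (3 + d))         ≡⟨ lem₁ (ballot 2 d) d ⟩
    2 * ballot 2 d + 2 * (3 + d)       ≡⟨ cong (_+ 2 * (3 + d)) (ballot-2 d) ⟩
    (1 + d) * (4 + d) + 2 * (3 + d)    ≡⟨ lem₂ d ⟩
    (2 + d) * (5 + d)                  ∎
    where
    lem₁ : ∀ b d → 2 * (b + (3 + d)) ≡ 2 * b + 2 * (3 + d)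
    lem₁ = solve-∀
    lem₂ : ∀ d → (1 + d) * (4 + d) + 2 * (3 + d) ≡ (2 + d) * (5 + d)
    lem₂ = solve-∀

  -- The relation is asked of members only, because `V t ≡ n` is known only there. Terms on both
  -- sides replace subtraction in ℕ.
  sum-linear : ∀ {A : Set} (f g h k : A → ℕ) a b c xs →
    (∀ {x} → x ∈ xs → f x + a * g x ≡ b * h x + c * k x) →
    sum (map f xs) + a * sum (map g xs) ≡ b * sum (map h xs) + c * sum (map k xs)
  sum-linear f g h k a b c []       eq = lem a b c
    where
    lem : ∀ a b c → 0 + a * 0 ≡ b * 0 + c * 0
    lem = solve-∀
  sum-linear f g h k a b c (x ∷ xs) eq = begin
    f x + F + a * (g x + G)                   ≡⟨ lem₁ a (f x) F (g x) G ⟩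
    f x + a * g x + (F + a * G)               ≡⟨ cong₂ _+_ (eq (here refl)) (sum-linear f g h k a b c xs (eq ∘ there)) ⟩
    b * h x + c * k x + (b * H + c * K)       ≡⟨ lem₂ b c (h x) H (k x) K ⟩
    b * (h x + H) + c * (k x + K)             ∎
    where
    F = sum (map f xs)
    G = sum (map g xs)
    H = sum (map h xs)
    K = sum (map k xs)
    lem₁ : ∀ a f F g G → f + F + a * (g + G) ≡ f + a * g + (F + a * G)
    lem₁ = solve-∀
    lem₂ : ∀ b c h H k K → b * h + c * k + (b * H + c * K) ≡ b * (h + H) + c * (k + K)
    lem₂ = solve-∀

  -- `ballot 0` is constantly 1, so `ballot n 0` is the Catalan number C_n.
  length-trees : ∀ n → length (trees n) ≡ ballot n 0
  length-trees n = trans (length≡sum (trees n)) (sum-trees-ballot n 0)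
    where
    length≡sum : ∀ {A : Set} (xs : List A) → length xs ≡ sum (map (λ _ → 1) xs)
    length≡sum []       = refl
    length≡sum (x ∷ xs) = cong suc (length≡sum xs)

  -- With b = D t + 1 = ballot 1 (D t) one has JD t = (n + 1) − b, and
  -- 2 * ballot 2 (D t) = b (b + 3); the subtractions are moved to the other side.
  sum-JD : ∀ n → sum (map JD (trees n)) + ballot (1 + n) 0 ≡ (n + 1) * ballot n 0
  sum-JD n = begin
    p + ballot (1 + n) 0                ≡⟨ cong (_+_ p) (sum-trees-ballot n 1) ⟨
    p + S 1                             ≡⟨ cong (_+_ p) (*-identityˡ (S 1)) ⟨
    p + 1 * S 1                         ≡⟨ sum-linear JD (ballot 1 ∘ D) (ballot 0 ∘ D) (ballot 0 ∘ D)
                                             1 (n + 1) 0 (trees n) pointwise ⟩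
    (n + 1) * S 0 + 0                   ≡⟨ +-identityʳ _ ⟩
    (n + 1) * S 0                       ≡⟨ cong ((n + 1) *_) (sum-trees-ballot n 0) ⟩
    (n + 1) * ballot n 0                ∎
    where
    p = sum (map JD (trees n))
    S : ℕ → ℕ
    S k = sum (map (ballot k ∘ D) (trees n))
    lem : ∀ j d → j + 1 * (1 + d) ≡ (j + d + 1) * 1 + 0
    lem = solve-∀
    pointwise : ∀ {t} → t ∈ trees n → JD t + 1 * ballot 1 (D t) ≡ (n + 1) * 1 + 0
    pointwise {t} t∈
      -- Replacing `n` by `V t` and then by `JD t + D t` leaves a polynomial identity in `JD t` and
      -- `D t`.
      rewrite ballot-1 (D t) | sym (Equivalence.to (∈-trees⇔ n t) t∈) | sym (JD+D≡V t) = lem (JD t) (D t)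

  -- Squaring JD = (n + 1) - b gives (n + 1)² - 2 (n + 1) b + b², where b² = 2 `ballot 2` - 3 b;
  -- hence the coefficient 2 (n + 1) + 3 = 2n + 5.
  sum-JD² : ∀ n → sum (map (λ t → JD t * JD t) (trees n)) + (n + n + 5) * ballot (1 + n) 0
    ≡ (n + 1) * (n + 1) * ballot n 0 + 2 * ballot (2 + n) 0
  sum-JD² n = begin
    q + (n + n + 5) * ballot (1 + n) 0         ≡⟨ cong (λ c → q + (n + n + 5) * c) (sum-trees-ballot n 1) ⟨
    q + (n + n + 5) * S 1                      ≡⟨ sum-linear (λ t → JD t * JD t) (ballot 1 ∘ D) (ballot 0 ∘ D) (ballot 2 ∘ D)
                                                    (n + n + 5) ((n + 1) * (n + 1)) 2 (trees n) pointwise ⟩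
    (n + 1) * (n + 1) * S 0 + 2 * S 2          ≡⟨ cong₂ (λ c d → (n + 1) * (n + 1) * c + 2 * d)
                                                    (sum-trees-ballot n 0) (sum-trees-ballot n 2) ⟩
    (n + 1) * (n + 1) * ballot n 0 + 2 * ballot (2 + n) 0 ∎
    where
    q = sum (map (λ t → JD t * JD t) (trees n))
    S : ℕ → ℕ
    S k = sum (map (ballot k ∘ D) (trees n))
    lem : ∀ j d → j * j + (j + d + (j + d) + 5) * (1 + d) ≡ (j + d + 1) * (j + d + 1) * 1 + (1 + d) * (4 + d)
    lem = solve-∀
    pointwise : ∀ {t} → t ∈ trees n → JD t * JD t + (n + n + 5) * ballot 1 (D t) ≡ (n + 1) * (n + 1) * 1 + 2 * ballot 2 (D t)
    pointwise {t} t∈ rewrite ballot-1 (D t) | ballot-2 (D t) | sym (Equivalence.to (∈-trees⇔ n t) t∈) | sym (JD+D≡V t) =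
      lem (JD t) (D t)

  -- Catalan recurrence and elimination over the integers.

  catalan-suc : ∀ n → (n + 2) * ballot (1 + n) 0 ≡ 2 * (n + n + 1) * ballot n 0
  catalan-suc n = begin
    (n + 2) * ballot n 1                          ≡⟨ lem₁ n (ballot n 1) ⟩
    ballot n 1 * ((1 + 0) * (2 + n + 0))          ≡⟨ ballot-ratio-d n 0 ⟩
    ballot n 0 * ((2 + 0) * (1 + (n + n + 0)))    ≡⟨ lem₂ n (ballot n 0) ⟩
    2 * (n + n + 1) * ballot n 0                  ∎
    where
    lem₁ : ∀ n c → (n + 2) * c ≡ c * ((1 + 0) * (2 + n + 0))
    lem₁ = solve-∀
    lem₂ : ∀ n c → c * ((2 + 0) * (1 + (n + n + 0))) ≡ 2 * (n + n + 1) * c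
    lem₂ = solve-∀

module _ where
  open import Data.Integer.Base using (_+_; _*_; _-_)
  open ℤ-Solver using (solve-∀)
  open ≡-Reasoning

  -- Here c_i stands for C_{n+i}, and `p`, `q` for the sums of JD and JD², so that `c₀ * q - p * p`
  -- is c₀² times the variance. First `p` and `q` are eliminated, then `c₂`, then `c₁`.
  variance-identity : ∀ k c₀ c₁ c₂ p q →
    p + c₁ ≡ (k + + 1) * c₀ →
    q + (k + k + + 5) * c₁ ≡ (k + + 1) * (k + + 1) * c₀ + + 2 * c₂ →
    (k + + 2) * c₁ ≡ + 2 * (k + k + + 1) * c₀ →
    (k + + 3) * c₂ ≡ + 2 * (k + k + + 3) * c₁ →
    (c₀ * q - p * p) * (k * k * k + + 7 * (k * k) + + 16 * k + + 12)
      ≡ + 2 * k * (+ 2 * (k * k) - k - + 1) * (c₀ * c₀)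
  variance-identity k c₀ c₁ c₂ p q p-eq q-eq c₁-eq c₂-eq = begin
    (c₀ * q - p * p) * (k * k * k + + 7 * (k * k) + + 16 * k + + 12)
      ≡⟨ s₁ k c₀ c₁ p q ⟩
    (c₀ * (q + (k + k + + 5) * c₁ - (k + k + + 5) * c₁) - (p + c₁ - c₁) * (p + c₁ - c₁)) * den
      ≡⟨ cong₂ (λ u v → (c₀ * (u - (k + k + + 5) * c₁) - (v - c₁) * (v - c₁)) * den) q-eq p-eq ⟩
    (c₀ * ((k + + 1) * (k + + 1) * c₀ + + 2 * c₂ - (k + k + + 5) * c₁) - ((k + + 1) * c₀ - c₁) * ((k + + 1) * c₀ - c₁)) * den
      -- The shift by `k + 1` cancels: what remains of the first factor is 2 c₀ c₂ - 3 c₀ c₁ - c₁²,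
      -- the scaled variance of D + 1.
      ≡⟨ s₂ k c₀ c₁ c₂ ⟩
    (k + + 2) * (k + + 2) * c₀ * (+ 2 * ((k + + 3) * c₂) - + 3 * (k + + 3) * c₁) - (k + + 3) * ((k + + 2) * c₁) * ((k + + 2) * c₁)
      ≡⟨ cong (λ u → (k + + 2) * (k + + 2) * c₀ * (+ 2 * u - + 3 * (k + + 3) * c₁) - (k + + 3) * ((k + + 2) * c₁) * ((k + + 2) * c₁)) c₂-eq ⟩
    (k + + 2) * (k + + 2) * c₀ * (+ 2 * (+ 2 * (k + k + + 3) * c₁) - + 3 * (k + + 3) * c₁) - (k + + 3) * ((k + + 2) * c₁) * ((k + + 2) * c₁)
      -- 5k + 3 = 4 (2k + 3) - 3 (k + 3).
      ≡⟨ s₃ k c₀ c₁ ⟩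
    (k + + 2) * c₀ * (+ 5 * k + + 3) * ((k + + 2) * c₁) - (k + + 3) * ((k + + 2) * c₁) * ((k + + 2) * c₁)
      ≡⟨ cong (λ u → (k + + 2) * c₀ * (+ 5 * k + + 3) * u - (k + + 3) * u * u) c₁-eq ⟩
    (k + + 2) * c₀ * (+ 5 * k + + 3) * (+ 2 * (k + k + + 1) * c₀) - (k + + 3) * (+ 2 * (k + k + + 1) * c₀) * (+ 2 * (k + k + + 1) * c₀)
      ≡⟨ s₄ k c₀ ⟩
    + 2 * k * (+ 2 * (k * k) - k - + 1) * (c₀ * c₀) ∎
    where
    den : ℤ
    -- The factored denominator: `k + 2` and `k + 3` are the leading coefficients of the two Catalan
    -- recurrences.
    den = (k + + 2) * (k + + 2) * (k + + 3)
    s₁ : ∀ k c₀ c₁ p q → (c₀ * q - p * p) * (k * k * k + + 7 * (k * k) + + 16 * k + + 12)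
       ≡ (c₀ * (q + (k + k + + 5) * c₁ - (k + k + + 5) * c₁) - (p + c₁ - c₁) * (p + c₁ - c₁)) * ((k + + 2) * (k + + 2) * (k + + 3))
    s₁ = solve-∀
    s₂ : ∀ k c₀ c₁ c₂ → (c₀ * ((k + + 1) * (k + + 1) * c₀ + + 2 * c₂ - (k + k + + 5) * c₁) - ((k + + 1) * c₀ - c₁) * ((k + + 1) * c₀ - c₁)) * ((k + + 2) * (k + + 2) * (k + + 3))
       ≡ (k + + 2) * (k + + 2) * c₀ * (+ 2 * ((k + + 3) * c₂) - + 3 * (k + + 3) * c₁) - (k + + 3) * ((k + + 2) * c₁) * ((k + + 2) * c₁)
    s₂ = solve-∀
    s₃ : ∀ k c₀ c₁ → (k + + 2) * (k + + 2) * c₀ * (+ 2 * (+ 2 * (k + k + + 3) * c₁) - + 3 * (k + + 3) * c₁) - (k + + 3) * ((k + + 2) * c₁) * ((k + + 2) * c₁)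
       ≡ (k + + 2) * c₀ * (+ 5 * k + + 3) * ((k + + 2) * c₁) - (k + + 3) * ((k + + 2) * c₁) * ((k + + 2) * c₁)
    s₃ = solve-∀
    s₄ : ∀ k c₀ → (k + + 2) * c₀ * (+ 5 * k + + 3) * (+ 2 * (k + k + + 1) * c₀) - (k + + 3) * (+ 2 * (k + k + + 1) * c₀) * (+ 2 * (k + k + + 1) * c₀)
       ≡ + 2 * k * (+ 2 * (k * k) - k - + 1) * (c₀ * c₀)
    s₄ = solve-∀

-- Embedding of the integers in the rationals.

fromℚᵘ-homo-* : ∀ p q → fromℚᵘ (p ℚᵘ.* q) ≡ fromℚᵘ p ℚ.* fromℚᵘ q
fromℚᵘ-homo-* p q = ℚₚ.toℚᵘ-injective (begin
  toℚᵘ (fromℚᵘ (p ℚᵘ.* q))                ≈⟨ ℚₚ.toℚᵘ-fromℚᵘ (p ℚᵘ.* q) ⟩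
  p ℚᵘ.* q                                ≈⟨ ℚᵘₚ.*-cong (ℚₚ.toℚᵘ-fromℚᵘ p) (ℚₚ.toℚᵘ-fromℚᵘ q) ⟨
  toℚᵘ (fromℚᵘ p) ℚᵘ.* toℚᵘ (fromℚᵘ q)    ≈⟨ ℚₚ.toℚᵘ-homo-* (fromℚᵘ p) (fromℚᵘ q) ⟨
  toℚᵘ (fromℚᵘ p ℚ.* fromℚᵘ q)            ∎)
  where open ≈-Reasoning ℚᵘₚ.≃-setoid

fromℚᵘ-homo-+ : ∀ p q → fromℚᵘ (p ℚᵘ.+ q) ≡ fromℚᵘ p ℚ.+ fromℚᵘ q
fromℚᵘ-homo-+ p q = ℚₚ.toℚᵘ-injective (begin
  toℚᵘ (fromℚᵘ (p ℚᵘ.+ q))                ≈⟨ ℚₚ.toℚᵘ-fromℚᵘ (p ℚᵘ.+ q) ⟩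
  p ℚᵘ.+ q                                ≈⟨ ℚᵘₚ.+-cong (ℚₚ.toℚᵘ-fromℚᵘ p) (ℚₚ.toℚᵘ-fromℚᵘ q) ⟨
  toℚᵘ (fromℚᵘ p) ℚᵘ.+ toℚᵘ (fromℚᵘ q)    ≈⟨ ℚₚ.toℚᵘ-homo-+ (fromℚᵘ p) (fromℚᵘ q) ⟨
  toℚᵘ (fromℚᵘ p ℚ.+ fromℚᵘ q)            ∎)
  where open ≈-Reasoning ℚᵘₚ.≃-setoid

ι : ℤ → ℚ
ι i = i ℚ./ 1

ι-* : ∀ i j → ι (i ℤ.* j) ≡ ι i ℚ.* ι j
ι-* i j = fromℚᵘ-homo-* (ℚᵘ.mkℚᵘ i 0) (ℚᵘ.mkℚᵘ j 0)

ι-+ : ∀ i j → ι (i ℤ.+ j) ≡ ι i ℚ.+ ι j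
ι-+ i j = trans
  -- Unnormalised addition cross-multiplies, giving `i * 1 + j * 1`.
  (cong ι (cong₂ ℤ._+_ (sym (ℤₚ.*-identityʳ i)) (sym (ℤₚ.*-identityʳ j))))
  (fromℚᵘ-homo-+ (ℚᵘ.mkℚᵘ i 0) (ℚᵘ.mkℚᵘ j 0))

ι-neg : ∀ i → ι (ℤ.- i) ≡ ℚ.- ι i
ι-neg i = ℚₚ.toℚᵘ-injective (begin
  toℚᵘ (ι (ℤ.- i))           ≈⟨ ℚₚ.toℚᵘ-fromℚᵘ (ℚᵘ.mkℚᵘ (ℤ.- i) 0) ⟩
  ℚᵘ.- (ℚᵘ.mkℚᵘ i 0)         ≈⟨ ℚᵘₚ.-‿cong (ℚₚ.toℚᵘ-fromℚᵘ (ℚᵘ.mkℚᵘ i 0)) ⟨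
  ℚᵘ.- toℚᵘ (ι i)            ≈⟨ ℚₚ.toℚᵘ-homo‿- (ι i) ⟨
  toℚᵘ (ℚ.- ι i)             ∎)
  where open ≈-Reasoning ℚᵘₚ.≃-setoid

-- Turns division into multiplication by `1 / d`, which the ring solver can treat as an atom.
ι-*-1/ : ∀ i d .{{_ : NonZero d}} → ι i ℚ.* (+ 1 ℚ./ d) ≡ i ℚ./ d
ι-*-1/ i (suc d) = trans
  (sym (fromℚᵘ-homo-* (ℚᵘ.mkℚᵘ i 0) (ℚᵘ.mkℚᵘ (+ 1) d)))
  (ℚₚ.fromℚᵘ-cong {ℚᵘ.mkℚᵘ i 0 ℚᵘ.* ℚᵘ.mkℚᵘ (+ 1) d} {ℚᵘ.mkℚᵘ i d} (ℚᵘ.*≡* (lem i (+ suc d))))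
  where
  lem : ∀ i d → i ℤ.* + 1 ℤ.* d ≡ i ℤ.* (+ 1 ℤ.* d)
  lem = ℤ-Solver.solve-∀

ι-*-1/-inverse : ∀ d .{{_ : NonZero d}} → ι (+ d) ℚ.* (+ 1 ℚ./ d) ≡ 1ℚ
ι-*-1/-inverse (suc d) = trans (ι-*-1/ (+ suc d) (suc d))
  (ℚₚ.fromℚᵘ-cong {ℚᵘ.mkℚᵘ (+ suc d) d} {ℚᵘ.mkℚᵘ (+ 1) 0} (ℚᵘ.*≡* (lem (+ suc d))))
  where
  lem : ∀ d → d ℤ.* + 1 ≡ + 1 ℤ.* d
  lem = ℤ-Solver.solve-∀

-- Variance in terms of power sums.

sumℚ : List ℚ → ℚ
sumℚ = foldr ℚ._+_ 0ℚ

sumℚ-ι : ∀ {A : Set} (f : A → ℕ) xs → sumℚ (map (λ x → ι (+ f x)) xs) ≡ ι (+ sum (map f xs))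
sumℚ-ι f []       = refl
sumℚ-ι f (x ∷ xs) = trans (cong (ι (+ f x) ℚ.+_) (sumℚ-ι f xs)) (sym (ι-+ (+ f x) (+ sum (map f xs))))

module _ {A : Set} (X : A → ℚ) where

  -- `μ` is arbitrary: the mean of the whole list must stay fixed while the induction shortens the
  -- list.
  sum-squared-deviations : ∀ μ xs →
    sumℚ (map (λ x → (X x ℚ.- μ) ℚ.* (X x ℚ.- μ)) xs)
      ≡ sumℚ (map (λ x → X x ℚ.* X x) xs) ℚ.- (μ ℚ.+ μ) ℚ.* sumℚ (map X xs) ℚ.+ μ ℚ.* μ ℚ.* ι (+ length xs)
  sum-squared-deviations μ [] =
    solve 1 (λ μ → con 0ℚ := con 0ℚ :- (μ :+ μ) :* con 0ℚ :+ μ :* μ :* con 0ℚ) refl μ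
    where open ℚ-Solver.+-*-Solver
  sum-squared-deviations μ (x ∷ xs) = begin
    d ℚ.+ sumℚ (map (λ x → (X x ℚ.- μ) ℚ.* (X x ℚ.- μ)) xs)
      ≡⟨ cong (d ℚ.+_) (sum-squared-deviations μ xs) ⟩
    d ℚ.+ (q ℚ.- (μ ℚ.+ μ) ℚ.* s ℚ.+ μ ℚ.* μ ℚ.* ι (+ length xs))
      ≡⟨ solve 5 (λ y μ q s l →
        (y :- μ) :* (y :- μ) :+ (q :- (μ :+ μ) :* s :+ μ :* μ :* l)
          := y :* y :+ q :- (μ :+ μ) :* (y :+ s) :+ μ :* μ :* (con 1ℚ :+ l))
        refl (X x) μ q s (ι (+ length xs)) ⟩
    X x ℚ.* X x ℚ.+ q ℚ.- (μ ℚ.+ μ) ℚ.* (X x ℚ.+ s) ℚ.+ μ ℚ.* μ ℚ.* (1ℚ ℚ.+ ι (+ length xs))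
      ≡⟨ cong (λ l → X x ℚ.* X x ℚ.+ q ℚ.- (μ ℚ.+ μ) ℚ.* (X x ℚ.+ s) ℚ.+ μ ℚ.* μ ℚ.* l) (ι-+ (+ 1) (+ length xs)) ⟨
    X x ℚ.* X x ℚ.+ q ℚ.- (μ ℚ.+ μ) ℚ.* (X x ℚ.+ s) ℚ.+ μ ℚ.* μ ℚ.* ι (+ length (x ∷ xs)) ∎
    where
    open ≡-Reasoning
    open ℚ-Solver.+-*-Solver
    d q s : ℚ
    d = (X x ℚ.- μ) ℚ.* (X x ℚ.- μ)
    q = sumℚ (map (λ x → X x ℚ.* X x) xs)
    s = sumℚ (map X xs)

  variance-moments : ∀ xs .{{_ : NonZero (length xs)}} →
    let s = sumℚ (map X xs) ; q = sumℚ (map (λ x → X x ℚ.* X x) xs) ; r = + 1 ℚ./ length xs in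
    variance X xs ≡ (ι (+ length xs) ℚ.* q ℚ.- s ℚ.* s) ℚ.* (r ℚ.* r)
  variance-moments xs = begin
    variance X xs
      ≡⟨ cong (ℚ._* r) (sum-squared-deviations (s ℚ.* r) xs) ⟩
    (q ℚ.- (s ℚ.* r ℚ.+ s ℚ.* r) ℚ.* s ℚ.+ s ℚ.* r ℚ.* (s ℚ.* r) ℚ.* l) ℚ.* r
      -- The solver does not know `l * r ≡ 1`. This form exposes one 1 to be expanded to `l * r` and
      -- one `l * r` to be contracted.
      ≡⟨ solve 4 (λ q s l r →
        (q :- (s :* r :+ s :* r) :* s :+ s :* r :* (s :* r) :* l) :* r
          := q :* r :* con 1ℚ :+ s :* s :* (r :* r) :* (l :* r :- con 1ℚ :- con 1ℚ))
        refl q s l r ⟩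
    q ℚ.* r ℚ.* 1ℚ ℚ.+ s ℚ.* s ℚ.* (r ℚ.* r) ℚ.* (l ℚ.* r ℚ.- 1ℚ ℚ.- 1ℚ)
      ≡⟨ cong₂ (λ u v → q ℚ.* r ℚ.* u ℚ.+ s ℚ.* s ℚ.* (r ℚ.* r) ℚ.* (v ℚ.- 1ℚ ℚ.- 1ℚ)) (sym lr) lr ⟩
    q ℚ.* r ℚ.* (l ℚ.* r) ℚ.+ s ℚ.* s ℚ.* (r ℚ.* r) ℚ.* (1ℚ ℚ.- 1ℚ ℚ.- 1ℚ)
      ≡⟨ solve 4 (λ q s l r →
        q :* r :* (l :* r) :+ s :* s :* (r :* r) :* (con 1ℚ :- con 1ℚ :- con 1ℚ)
          := (l :* q :- s :* s) :* (r :* r))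
        refl q s l r ⟩
    (l ℚ.* q ℚ.- s ℚ.* s) ℚ.* (r ℚ.* r) ∎
    where
    open ≡-Reasoning
    open ℚ-Solver.+-*-Solver
    l q s r : ℚ
    l = ι (+ length xs)
    q = sumℚ (map (λ x → X x ℚ.* X x) xs)
    s = sumℚ (map X xs)
    r = + 1 ℚ./ length xs
    lr : l ℚ.* r ≡ 1ℚ
    lr = ι-*-1/-inverse (length xs)

-- Cross-multiplication: inserting `b * (1 / b)` makes the integer hypothesis applicable.
ι-quotient : ∀ i l a b .{{_ : NonZero l}} .{{_ : NonZero b}} → i ℤ.* + b ≡ a ℤ.* (+ l ℤ.* + l) →
  ι i ℚ.* ((+ 1 ℚ./ l) ℚ.* (+ 1 ℚ./ l)) ≡ a ℚ./ b
ι-quotient i l a b eq = begin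
  ι i ℚ.* (r ℚ.* r)                               ≡⟨ ℚₚ.*-identityʳ _ ⟨
  ι i ℚ.* (r ℚ.* r) ℚ.* 1ℚ                        ≡⟨ cong (ι i ℚ.* (r ℚ.* r) ℚ.*_) (ι-*-1/-inverse b) ⟨
  ι i ℚ.* (r ℚ.* r) ℚ.* (ι (+ b) ℚ.* β)
    ≡⟨ solve 4 (λ n r b β → n :* (r :* r) :* (b :* β) := n :* b :* (r :* r :* β)) refl (ι i) r (ι (+ b)) β ⟩
  ι i ℚ.* ι (+ b) ℚ.* (r ℚ.* r ℚ.* β)             ≡⟨ cong (ℚ._* (r ℚ.* r ℚ.* β)) ι-eq ⟩
  ι a ℚ.* (ι (+ l) ℚ.* ι (+ l)) ℚ.* (r ℚ.* r ℚ.* β)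
    ≡⟨ solve 4 (λ a l r β → a :* (l :* l) :* (r :* r :* β) := a :* β :* ((l :* r) :* (l :* r))) refl (ι a) (ι (+ l)) r β ⟩
  ι a ℚ.* β ℚ.* ((ι (+ l) ℚ.* r) ℚ.* (ι (+ l) ℚ.* r)) ≡⟨ cong (λ o → ι a ℚ.* β ℚ.* (o ℚ.* o)) (ι-*-1/-inverse l) ⟩
  ι a ℚ.* β ℚ.* 1ℚ                                ≡⟨ ℚₚ.*-identityʳ _ ⟩
  ι a ℚ.* β                                       ≡⟨ ι-*-1/ a b ⟩
  a ℚ./ b                                         ∎
  where
  open ≡-Reasoning
  open ℚ-Solver.+-*-Solver
  r β : ℚ
  r = + 1 ℚ./ l
  β = + 1 ℚ./ b
  ι-eq : ι i ℚ.* ι (+ b) ≡ ι a ℚ.* (ι (+ l) ℚ.* ι (+ l))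
  ι-eq = begin
    ι i ℚ.* ι (+ b)                     ≡⟨ ι-* i (+ b) ⟨
    ι (i ℤ.* + b)                       ≡⟨ cong ι eq ⟩
    ι (a ℤ.* (+ l ℤ.* + l))             ≡⟨ ι-* a (+ l ℤ.* + l) ⟩
    ι a ℚ.* ι (+ l ℤ.* + l)             ≡⟨ cong (ι a ℚ.*_) (ι-* (+ l) (+ l)) ⟩
    ι a ℚ.* (ι (+ l) ℚ.* ι (+ l))       ∎

variance-ι : ∀ {A : Set} (f : A → ℕ) xs a b .{{_ : NonZero (length xs)}} .{{_ : NonZero b}} →
  let l = + length xs ; s = + sum (map f xs) ; q = + sum (map (λ x → f x ℕ.* f x) xs) in
  (l ℤ.* q ℤ.- s ℤ.* s) ℤ.* + b ≡ a ℤ.* (l ℤ.* l) →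
  variance (λ x → + f x ℚ./ 1) xs ≡ a ℚ./ b
variance-ι f xs a b eq = begin
  variance X xs                                   ≡⟨ variance-moments X xs ⟩
  (ι l ℚ.* sumℚ (map (λ x → X x ℚ.* X x) xs) ℚ.- sumℚ (map X xs) ℚ.* sumℚ (map X xs)) ℚ.* (r ℚ.* r)
    ≡⟨ cong₂ (λ q s → (ι l ℚ.* q ℚ.- s ℚ.* s) ℚ.* (r ℚ.* r)) sumℚ-X² (sumℚ-ι f xs) ⟩
  (ι l ℚ.* ι q ℚ.- ι s ℚ.* ι s) ℚ.* (r ℚ.* r)     ≡⟨ cong (ℚ._* (r ℚ.* r)) ι-numerator ⟨
  ι (l ℤ.* q ℤ.- s ℤ.* s) ℚ.* (r ℚ.* r)           ≡⟨ ι-quotient (l ℤ.* q ℤ.- s ℤ.* s) (length xs) a b eq ⟩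
  a ℚ./ b                                         ∎
  where
  open ≡-Reasoning
  X : _ → ℚ
  X x = ι (+ f x)
  l q s : ℤ
  l = + length xs
  q = + sum (map (λ x → f x ℕ.* f x) xs)
  s = + sum (map f xs)
  r : ℚ
  r = + 1 ℚ./ length xs
  sumℚ-X² : sumℚ (map (λ x → X x ℚ.* X x) xs) ≡ ι q
  sumℚ-X² = begin
    sumℚ (map (λ x → X x ℚ.* X x) xs)
      ≡⟨ cong sumℚ (map-cong (λ x → trans (sym (ι-* (+ f x) (+ f x))) (cong ι (sym (ℤₚ.pos-* (f x) (f x))))) xs) ⟩
    sumℚ (map (λ x → ι (+ (f x ℕ.* f x))) xs)   ≡⟨ sumℚ-ι (λ x → f x ℕ.* f x) xs ⟩
    ι q                                         ∎
  ι-numerator : ι (l ℤ.* q ℤ.- s ℤ.* s) ≡ ι l ℚ.* ι q ℚ.- ι s ℚ.* ι s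
  ι-numerator = begin
    ι (l ℤ.* q ℤ.- s ℤ.* s)             ≡⟨ ι-+ (l ℤ.* q) (ℤ.- (s ℤ.* s)) ⟩
    ι (l ℤ.* q) ℚ.+ ι (ℤ.- (s ℤ.* s))   ≡⟨ cong (ι (l ℤ.* q) ℚ.+_) (ι-neg (s ℤ.* s)) ⟩
    ι (l ℤ.* q) ℚ.- ι (s ℤ.* s)         ≡⟨ cong₂ ℚ._-_ (ι-* l q) (ι-* s s) ⟩
    ι l ℚ.* ι q ℚ.- ι s ℚ.* ι s         ∎

-- Transfer of the counting identities to the variance.

theorem8p2 : ∀ (n : ℕ) →
    variance (λ t → + JD t ℚ./ 1) (trees n) {{trees-nonEmpty n}}
    ≡ (+ 2 ℤ.* + n ℤ.* (+ 2 ℤ.* (+ n) ℤ.^ 2 ℤ.- + n ℤ.- + 1))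
    ℚ./ (n ℕ.^ 3 ℕ.+ 7 ℕ.* n ℕ.^ 2 ℕ.+ 16 ℕ.* n ℕ.+ 12)
theorem8p2 n = variance-ι JD (trees n) (+ 2 * k * (+ 2 * k ℤ.^ 2 - k - + 1)) _ {{trees-nonEmpty n}} (begin
  (l * q - p * p) * + (n ℕ.^ 3 ℕ.+ 7 ℕ.* n ℕ.^ 2 ℕ.+ 16 ℕ.* n ℕ.+ 12)
    ≡⟨ cong ((l * q - p * p) *_) denominator ⟩
  (l * q - p * p) * (k * k * k + + 7 * (k * k) + + 16 * k + + 12)
    ≡⟨ variance-identity k l (C 1) (C 2) p q p-eq q-eq c₁-eq c₂-eq ⟩
  + 2 * k * (+ 2 * (k * k) - k - + 1) * (l * l)
    -- `k ^ 2` unfolds to `k * (k * 1)`.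
    ≡⟨ cong (λ x → + 2 * k * (+ 2 * (k * x) - k - + 1) * (l * l)) (ℤₚ.*-identityʳ k) ⟨
  + 2 * k * (+ 2 * k ℤ.^ 2 - k - + 1) * (l * l) ∎)
  where
  open ≡-Reasoning
  open import Data.Integer.Base using (_+_; _*_; _-_)
  C : ℕ → ℤ
  C i = + ballot (i ℕ.+ n) 0
  k l p q : ℤ
  k = + n
  l = + length (trees n)
  p = + sum (map JD (trees n))
  q = + sum (map (λ t → JD t ℕ.* JD t) (trees n))
  l≡C₀ : l ≡ C 0
  l≡C₀ = cong +_ (length-trees n)
  p-eq : p + C 1 ≡ (k + + 1) * l
  p-eq = begin
    -- `+_` commutes with addition by computation, but with multiplication only through `pos-*`.
    p + C 1                               ≡⟨ cong +_ (sum-JD n) ⟩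
    + ((n ℕ.+ 1) ℕ.* ballot n 0)          ≡⟨ ℤₚ.pos-* (n ℕ.+ 1) (ballot n 0) ⟩
    (k + + 1) * C 0                       ≡⟨ cong ((k + + 1) *_) l≡C₀ ⟨
    (k + + 1) * l                         ∎
  q-eq : q + (k + k + + 5) * C 1 ≡ (k + + 1) * (k + + 1) * l + + 2 * C 2
  q-eq = begin
    q + (k + k + + 5) * C 1
      ≡⟨ cong (λ x → q + x) (ℤₚ.pos-* (n ℕ.+ n ℕ.+ 5) (ballot (1 ℕ.+ n) 0)) ⟨
    + (sum (map (λ t → JD t ℕ.* JD t) (trees n)) ℕ.+ (n ℕ.+ n ℕ.+ 5) ℕ.* ballot (1 ℕ.+ n) 0)
      ≡⟨ cong +_ (sum-JD² n) ⟩
    + ((n ℕ.+ 1) ℕ.* (n ℕ.+ 1) ℕ.* ballot n 0) + + (2 ℕ.* ballot (2 ℕ.+ n) 0)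
      ≡⟨ cong₂ _+_ (ℤₚ.pos-* ((n ℕ.+ 1) ℕ.* (n ℕ.+ 1)) (ballot n 0)) (ℤₚ.pos-* 2 (ballot (2 ℕ.+ n) 0)) ⟩
    + ((n ℕ.+ 1) ℕ.* (n ℕ.+ 1)) * C 0 + + 2 * C 2
      ≡⟨ cong₂ (λ x y → x * y + + 2 * C 2) (ℤₚ.pos-* (n ℕ.+ 1) (n ℕ.+ 1)) (sym l≡C₀) ⟩
    (k + + 1) * (k + + 1) * l + + 2 * C 2 ∎
  catalan-eq : ∀ m → (+ m + + 2) * + ballot (1 ℕ.+ m) 0 ≡ + 2 * (+ m + + m + + 1) * + ballot m 0
  catalan-eq m = begin
    (+ m + + 2) * + ballot (1 ℕ.+ m) 0            ≡⟨ ℤₚ.pos-* (m ℕ.+ 2) (ballot (1 ℕ.+ m) 0) ⟨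
    + ((m ℕ.+ 2) ℕ.* ballot (1 ℕ.+ m) 0)          ≡⟨ cong +_ (catalan-suc m) ⟩
    + (2 ℕ.* (m ℕ.+ m ℕ.+ 1) ℕ.* ballot m 0)      ≡⟨ ℤₚ.pos-* (2 ℕ.* (m ℕ.+ m ℕ.+ 1)) (ballot m 0) ⟩
    + (2 ℕ.* (m ℕ.+ m ℕ.+ 1)) * + ballot m 0      ≡⟨ cong (_* + ballot m 0) (ℤₚ.pos-* 2 (m ℕ.+ m ℕ.+ 1)) ⟩
    + 2 * (+ m + + m + + 1) * + ballot m 0        ∎
  c₁-eq : (k + + 2) * C 1 ≡ + 2 * (k + k + + 1) * l
  c₁-eq = trans (catalan-eq n) (cong (+ 2 * (k + k + + 1) *_) (sym l≡C₀))
  c₂-eq : (k + + 3) * C 2 ≡ + 2 * (k + k + + 3) * C 1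
  c₂-eq = begin
    (k + + 3) * C 2                           ≡⟨ lem₁ k (C 2) ⟩
    (+ 1 + k + + 2) * C 2                     ≡⟨ catalan-eq (1 ℕ.+ n) ⟩
    + 2 * (+ 1 + k + (+ 1 + k) + + 1) * C 1   ≡⟨ lem₂ k (C 1) ⟩
    + 2 * (k + k + + 3) * C 1                 ∎
    where
    lem₁ : ∀ k c → (k + + 3) * c ≡ (+ 1 + k + + 2) * c
    lem₁ = ℤ-Solver.solve-∀
    lem₂ : ∀ k c → + 2 * (+ 1 + k + (+ 1 + k) + + 1) * c ≡ + 2 * (k + k + + 3) * c
    lem₂ = ℤ-Solver.solve-∀
  pos-^² : + (n ℕ.^ 2) ≡ k * k
  pos-^² = trans (ℤₚ.pos-* n (n ℕ.* 1)) (cong (λ x → k * + x) (ℕₚ.*-identityʳ n))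
  pos-^³ : + (n ℕ.^ 3) ≡ k * k * k
  pos-^³ = trans (ℤₚ.pos-* n (n ℕ.^ 2)) (trans (cong (k *_) pos-^²) (sym (ℤₚ.*-assoc k k k)))
  denominator : + (n ℕ.^ 3 ℕ.+ 7 ℕ.* n ℕ.^ 2 ℕ.+ 16 ℕ.* n ℕ.+ 12) ≡ k * k * k + + 7 * (k * k) + + 16 * k + + 12
  denominator = cong (_+ + 12) (cong₂ _+_
    (cong₂ _+_ pos-^³ (trans (ℤₚ.pos-* 7 (n ℕ.^ 2)) (cong (+ 7 *_) pos-^²)))
    (ℤₚ.pos-* 16 n))
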